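{- Let $\{\mathcal{V}_n\mid n<\omega\}$ be an ascending chain of group varieties, let $\mathcal{V}=\bigcup_{n<\omega}\mathcal{V}_n$, and let $\lambda$ be a cardinal such that $\lambda=\lambda^{<\lambda}$. Then there exists an epi-universal group in the class $\mathcal{LV}_\lambda$ of all $\mathcal{LV}$-groups of cardinality $\le\lambda$.
   Context: Ascending means $\mathcal{V}_n\subseteq\mathcal{V}_{n+1}$ for all $n<\omega$; each $\mathcal{V}_n$ is generated (defined) by a set $E_n$ of identities, where it is assumed that $E_n\supseteq E_{n+1}$. A group $G$ is an $\mathcal{LV}$-group (a $\mathcal{V}$-locally group) if every finitely generated subgroup of $G$ belongs to $\mathcal{V}$; $\mathcal{LV}$ is the class of all such groups. For a class $\mathcal{K}$ of groups, $\mathcal{K}_\lambda$ is the subclass of all members of $\mathcal{K}$ of cardinality at most $\lambda$, and a group $G\in\mathcal{K}$ with $|G|=\lambda$ is called epi-universal in $\mathcal{K}_\lambda$ if every group in $\mathcal{K}_\lambda$ is an epimorphic image of $G$ (i.e. the image of $G$ under a surjective group homomorphism). Here this is applied with $\mathcal{K}=\mathcal{LV}$. As usual, $\lambda^{<\lambda}=\sup\{\lambda^{\mu}\mid\mu<\lambda\text{ a cardinal}\}$.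
   Formalization: The formal theorem also assumes that λ is infinite and that some 𝒱_n contains a nontrivial group; otherwise the claim can fail, e.g. all 𝒱_n trivial with λ = ℵ₀, or λ = 0, or λ = 2 with all 𝒱_n of exponent 3, where no LV-group has cardinality λ. -}

module Defs where

open import Level using (Level; _⊔_; suc)
open import Algebra.Bundles using (Group)
open import Algebra.Morphism.Structures using (module GroupMorphisms)
open import Data.List.Base using (List)
import Data.List.Membership.Setoid as Membership
open import Data.Nat.Base using (ℕ)
open import Data.Product.Base using (Σ; ∃; _×_; _,_; proj₁)
open import Function.Base using (_on_)
open import Function.Bundles using (Func; Injection; Inverse; _⟨$⟩_; _⇔_)
open import Function.Definitions using (Surjective)
open import Function.Relation.Binary.Setoid.Equality using (_⇨_)
open import Relation.Binary.Bundles using (Setoid)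
open import Relation.Binary.Core using (REL)
open import Relation.Binary.Definitions using (_Respectsˡ_; _Respectsʳ_)
import Relation.Binary.PropositionalEquality.Properties as ≡
open import Relation.Nullary.Negation.Core using (¬_)
open import Relation.Unary using (Pred)

private
  variable
    a b ℓ p : Level

-- Choice for setoids: the chosen function has to respect the equalities.
-- Unlike its intensional counterpart, which is provable, this is the
-- set-theoretic axiom; by Diaconescu's argument (choose representatives in
-- quotients of a two-element setoid) it yields excluded middle for Set ℓ.

AxiomOfChoice : ∀ ℓ → Set (suc ℓ)
AxiomOfChoice ℓ = (A B : Setoid ℓ ℓ) →
  let module A = Setoid A
      module B = Setoid B
  in (R : REL A.Carrier B.Carrier ℓ) → R Respectsˡ A._≈_ → R Respectsʳ B._≈_ →
     (∀ x → ∃ λ y → R x y) →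
     Σ (Func A B) λ f → ∀ x → R x (f ⟨$⟩ x)

-- Sets are setoids.  A cardinal is given by any set having it, so equality of
-- cardinals is equinumerosity.

Cardinal : ∀ ℓ → Set (suc ℓ)
Cardinal ℓ = Setoid ℓ ℓ

infix 4 _≈ᶜ_ _≤ᶜ_ _<ᶜ_

_≈ᶜ_ : Setoid a a → Setoid b b → Set (a ⊔ b)
κ ≈ᶜ μ = Inverse κ μ

_≤ᶜ_ : Setoid a a → Setoid b b → Set (a ⊔ b)
κ ≤ᶜ μ = Injection κ μ

_<ᶜ_ : Setoid a a → Setoid b b → Set (a ⊔ b)
κ <ᶜ μ = κ ≤ᶜ μ × ¬ (κ ≈ᶜ μ)

ℵ₀ : Cardinal Level.zero
ℵ₀ = ≡.setoid ℕ

Infinite : Cardinal ℓ → Set ℓ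
Infinite κ = ℵ₀ ≤ᶜ κ

infixr 8 _^ᶜ_

_^ᶜ_ : Cardinal ℓ → Cardinal ℓ → Cardinal ℓ
κ ^ᶜ μ = μ ⇨ κ

IsSupremum : Pred (Cardinal ℓ) p → Cardinal ℓ → Set (suc ℓ ⊔ p)
IsSupremum {ℓ} S κ =
  (∀ ν → S ν → ν ≤ᶜ κ) ×
  ((θ : Cardinal ℓ) → (∀ ν → S ν → ν ≤ᶜ θ) → κ ≤ᶜ θ)

-- κ = κ^{<κ}, with κ^{<κ} = sup { κ^μ ∣ μ < κ }

IsWeakPowerFixed : Cardinal ℓ → Set (suc ℓ)
IsWeakPowerFixed {ℓ} κ =
  IsSupremum (λ ν → Σ (Cardinal ℓ) λ μ → μ <ᶜ κ × ν ≈ᶜ κ ^ᶜ μ) κ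

data Term : Set where
  var  : ℕ → Term
  ε′   : Term
  _∙′_ : Term → Term → Term
  _⁻¹′ : Term → Term

Identity : Set
Identity = Term × Term

module _ (G : Group ℓ ℓ) where
  open Group G

  ⟦_⟧ : Term → (ℕ → Carrier) → Carrier
  ⟦ var i ⟧   ρ = ρ i
  ⟦ ε′ ⟧      ρ = ε
  ⟦ s ∙′ t ⟧  ρ = ⟦ s ⟧ ρ ∙ ⟦ t ⟧ ρ
  ⟦ t ⁻¹′ ⟧   ρ = ⟦ t ⟧ ρ ⁻¹

  Satisfies : Identity → Set ℓ
  Satisfies (s , t) = ∀ ρ → ⟦ s ⟧ ρ ≈ ⟦ t ⟧ ρ

GroupClass : ∀ ℓ p → Set (suc ℓ ⊔ suc p)
GroupClass ℓ p = Pred (Group ℓ ℓ) p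

IsVariety : GroupClass ℓ p → Set (suc ℓ ⊔ p)
IsVariety {ℓ} 𝒞 = Σ (Pred Identity ℓ) λ E →
  ∀ G → 𝒞 G ⇔ (∀ e → E e → Satisfies G e)

Nontrivial : GroupClass ℓ p → Set (suc ℓ ⊔ p)
Nontrivial 𝒞 = ∃ λ G → 𝒞 G × let open Group G in ∃ λ x → ¬ (x ≈ ε)

record Subgroup (G : Group ℓ ℓ) : Set (suc ℓ) where
  open Group G
  field
    member  : Pred Carrier ℓ
    resp    : ∀ {x y} → x ≈ y → member x → member y
    ε-mem   : member ε
    ∙-mem   : ∀ {x y} → member x → member y → member (x ∙ y)
    ⁻¹-mem  : ∀ {x} → member x → member (x ⁻¹)

  group : Group ℓ ℓ
  group = record
    { Carrier = Σ Carrier member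
    ; _≈_     = _≈_ on proj₁
    ; _∙_     = λ (x , hx) (y , hy) → x ∙ y , ∙-mem hx hy
    ; ε       = ε , ε-mem
    ; _⁻¹     = λ (x , hx) → x ⁻¹ , ⁻¹-mem hx
    ; isGroup = record
      { isMonoid = record
        { isSemigroup = record
          { isMagma = record
            { isEquivalence = record { refl = refl ; sym = sym ; trans = trans }
            ; ∙-cong        = ∙-cong
            }
          ; assoc = λ (x , _) (y , _) (z , _) → assoc x y z
          }
        ; identity = (λ (x , _) → identityˡ x) , (λ (x , _) → identityʳ x)
        }
      ; inverse = (λ (x , _) → inverseˡ x) , (λ (x , _) → inverseʳ x)
      ; ⁻¹-cong = ⁻¹-cong
      }
    }

module _ (G : Group ℓ ℓ) where
  open Group G
  open Membership setoid using (_∈_)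

  data Generated (xs : List Carrier) : Pred Carrier ℓ where
    gen  : ∀ {x} → x ∈ xs → Generated xs x
    resp : ∀ {x y} → x ≈ y → Generated xs x → Generated xs y
    ε-mem   : Generated xs ε
    ∙-mem   : ∀ {x y} → Generated xs x → Generated xs y → Generated xs (x ∙ y)
    ⁻¹-mem  : ∀ {x} → Generated xs x → Generated xs (x ⁻¹)

FinitelyGenerated : {G : Group ℓ ℓ} → Subgroup G → Set ℓ
FinitelyGenerated {G = G} H =
  ∃ λ xs → ∀ x → Subgroup.member H x ⇔ Generated G xs x

Locally : GroupClass ℓ p → GroupClass ℓ (suc ℓ ⊔ p)
Locally 𝒱 G = (H : Subgroup G) → FinitelyGenerated H → 𝒱 (Subgroup.group H)

∣_∣ : Group ℓ ℓ → Cardinal ℓ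
∣ G ∣ = Group.setoid G

OfCardinality≤ : Cardinal ℓ → GroupClass ℓ p → GroupClass ℓ (ℓ ⊔ p)
OfCardinality≤ κ 𝒦 G = 𝒦 G × ∣ G ∣ ≤ᶜ κ

EpimorphicImage : Group ℓ ℓ → Group ℓ ℓ → Set ℓ
EpimorphicImage H G = ∃ λ f →
  GroupMorphisms.IsGroupHomomorphism G.rawGroup H.rawGroup f ×
  Surjective G._≈_ H._≈_ f
  where
  module G = Group G
  module H = Group H

EpiUniversal : GroupClass ℓ p → Cardinal ℓ → Group ℓ ℓ → Set (suc ℓ ⊔ p)
EpiUniversal 𝒦 κ G =
  𝒦 G × ∣ G ∣ ≈ᶜ κ × (∀ H → OfCardinality≤ κ 𝒦 H → EpimorphicImage H G)

{-# OPTIONS --safe #-}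
-- Order a set K of cardinality κ linearly so that all initial segments are smaller
-- than κ.  Given a locally-𝒱 group H with its elements indexed by K, attach to each
-- index x the function that maps a finite list t of indices below x to some n such
-- that the elements of x ∷ t generate a group in 𝒱 n.  As κ^μ ≤ κ for μ < κ, at most
-- κ functions arise in this way, whatever H is, so they can be coded in K.  Read a
-- pair (x , c) as the index x with the prediction c of its function, and let F be
-- generated by all pairs, subject to the laws of 𝒱 n for the words over each finite
-- list s, where n is the largest value predicted by a member of s for the indices in
-- s below it.  By construction F is locally 𝒱.  It maps onto H: send (x , c) to the
-- x-th element if the prediction c is correct for H, and to ε otherwise.  For a
-- finite list s, the last index in s with a correct prediction bounds n from below
-- as required.

module Submission where

open import Defs
open import Level using (Level; Lift; lift; lower)
open import Algebra.Bundles using (Group)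
open import Algebra.Morphism.Structures using (module GroupMorphisms)
import Algebra.Properties.Group as GroupProperties
open import Data.Bool.Base using (Bool; true; false; T; if_then_else_)
import Data.Bool.Properties as Bool
open import Data.Empty using (⊥; ⊥-elim)
open import Data.List.Base using (List; []; _∷_; _++_; filter; length; map; upTo)
open import Data.List.Extrema.Nat using (max; xs≤max)
open import Data.List.Membership.Propositional using (_∈_)
open import Data.List.Membership.Propositional.Properties
  using (∈-map⁺; ∈-map⁻; ∈-++⁺ˡ; ∈-++⁺ʳ; ∈-filter⁺; ∈-filter⁻; ∈-upTo⁺)
import Data.List.Relation.Binary.Subset.Propositional as Subset
open import Data.List.Relation.Unary.All using (All; []; _∷_; tabulate; lookup)
import Data.List.Relation.Unary.All.Properties as All
open import Data.List.Relation.Unary.Any as Any using (Any; here; there)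
open import Data.Nat.Base using (ℕ; zero; suc; _+_; _≤_; _<ᵇ_; _≤′_; ≤′-refl; ≤′-step)
import Data.Nat.Properties as ℕ
open import Data.Product.Base using (Σ; ∃; _×_; _,_; proj₁; proj₂)
open import Data.Sum.Base using (_⊎_; inj₁; inj₂; [_,_])
open import Data.Unit.Polymorphic.Base using (⊤; tt)
open import Function.Base using (id; _∘_; case_of_)
open import Function.Bundles using (Bijection; Equivalence; Func; Injection; Inverse; mk⇔; _⇔_)
import Function.Construct.Composition as Compose
open import Function.Definitions using (Surjective)
open import Function.Properties.Bijection using (Bijection⇒Inverse)
import Function.Properties.Inverse as Inv
open import Function.Relation.Binary.Setoid.Equality using (_⇨_)
open import Relation.Binary.Bundles using (Setoid)
open import Relation.Binary.Definitions using (tri<; tri≈; tri>)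
open import Relation.Binary.PropositionalEquality
  using (_≡_; refl; sym; trans; cong; cong₂; subst; subst₂)
import Relation.Binary.PropositionalEquality.Properties as ≡
open import Relation.Binary.PropositionalEquality.WithK using (≡-irrelevant)
open import Relation.Nullary using (¬_; Dec; yes; no; contradiction)
open import Relation.Nullary.Decidable
  using (T?; decidable-stable; fromWitness; isYes; toWitness)
open import Relation.Unary using (Pred; _⊆_; ⋃)

private
  variable
    ℓ : Level
    A : Set ℓ

-- Normal forms, excluded middle and cardinals

-- One representative per class, chosen up to `_≡_`: this replaces setoids by types with
-- propositional equality.
NormalForm : Setoid ℓ ℓ → Set ℓ
NormalForm A = let open Setoid A in
  Σ (Carrier → Carrier) λ nf → (∀ x → x ≈ nf x) × (∀ {x y} → x ≈ y → nf x ≡ nf y)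

module _ (ac : AxiomOfChoice ℓ) where

  normalForm : ∀ A → NormalForm A
  normalForm A = Func.to f , proj₂ choice , Func.cong f
    where
    module A = Setoid A
    -- The target is discrete, so a choice function that respects the equalities sends equivalent
    -- elements to identical ones.
    choice = ac A (≡.setoid A.Carrier) A._≈_
      (λ x≈x′ x≈y → A.trans (A.sym x≈x′) x≈y) (λ { refl x≈y → x≈y }) (λ x → x , A.refl)
    f = proj₁ choice

  -- Diaconescu: the normal forms of true and false coincide iff P identifies them.
  excludedMiddle : (P : Set ℓ) → Dec P
  excludedMiddle P = decide (normalForm B)
    where
    B : Setoid ℓ ℓ
    B = record
      { Carrier = Lift ℓ Bool
      ; _≈_ = λ x y → (x ≡ y) ⊎ P
      ; isEquivalence = record
        { refl = inj₁ refl
        ; sym = λ { (inj₁ x≡y) → inj₁ (sym x≡y) ; (inj₂ p) → inj₂ p }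
        ; trans = λ { (inj₁ refl) q → q ; (inj₂ p) _ → inj₂ p }
        }
      }
    open Setoid B using (_≈_) renaming (sym to ≈-sym; trans to ≈-trans)
    decide : NormalForm B → Dec P
    decide (nf , ≈nf , nf-cong)
      with lower (nf (lift true)) Bool.≟ lower (nf (lift false))
    ... | no ≢ = no λ p → ≢ (cong lower (nf-cong (inj₂ p)))
    ... | yes ≡ = [ (λ ()) , yes ]
      (≈-trans (≈nf (lift true)) (≈-trans (inj₁ (cong lift ≡)) (≈-sym (≈nf (lift false)))))

-- The Schröder-Bernstein theorem and retractions

module Classical {ℓ} (lem : (P : Set ℓ) → Dec P) where

  module _ (X Y : Setoid ℓ ℓ) (f : X ≤ᶜ Y) (g : Y ≤ᶜ X) where
    private
      module X = Setoid X
      module Y = Setoid Y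
      module f = Injection f
      module g = Injection g

    -- The points reached by iterating `g` after `f` from outside the range of `g`. The bijection is
    -- `f` on them and the inverse of `g` elsewhere.
    data Chain : X.Carrier → Set ℓ where
      start : ∀ {x} → (∀ y → ¬ g.to y X.≈ x) → Chain x
      next  : ∀ {x x′} → g.to (f.to x) X.≈ x′ → Chain x → Chain x′

    Chain-resp : ∀ {x x′} → x X.≈ x′ → Chain x → Chain x′
    Chain-resp x≈x′ (start p)  = start λ y gy≈x′ → p y (X.trans gy≈x′ (X.sym x≈x′))
    Chain-resp x≈x′ (next q c) = next (X.trans q x≈x′) c

    -- The bijection as a relation, so that the proofs about it do not depend on the case
    -- distinctions in `match`.
    Match : X.Carrier → Y.Carrier → Set ℓ
    Match x y = (Chain x × y Y.≈ f.to x) ⊎ (¬ Chain x × g.to y X.≈ x)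

    match : ∀ x → ∃ (Match x)
    match x with lem (Chain x)
    ... | yes c = f.to x , inj₁ (c , Y.refl)
    ... | no ¬c with lem (∃ λ y → g.to y X.≈ x)
    ...   | yes (y , gy≈x) = y , inj₂ (¬c , gy≈x)
    ...   | no ¬∃ = contradiction (start λ y gy≈x → ¬∃ (y , gy≈x)) ¬c

    match-functional : ∀ {x x′ y y′} → Match x y → Match x′ y′ → x X.≈ x′ → y Y.≈ y′
    match-functional (inj₁ (_ , p)) (inj₁ (_ , q)) e = Y.trans p (Y.trans (f.cong e) (Y.sym q))
    match-functional (inj₁ (c , _)) (inj₂ (¬c , _)) e = contradiction (Chain-resp e c) ¬c
    match-functional (inj₂ (¬c , _)) (inj₁ (c , _)) e = contradiction (Chain-resp (X.sym e) c) ¬c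
    match-functional (inj₂ (_ , p)) (inj₂ (_ , q)) e = g.injective (X.trans p (X.trans e (X.sym q)))

    match-injective : ∀ {x x′ y y′} → Match x y → Match x′ y′ → y Y.≈ y′ → x X.≈ x′
    match-injective (inj₁ (_ , p)) (inj₁ (_ , q)) e =
      f.injective (Y.trans (Y.sym p) (Y.trans e q))
    match-injective (inj₁ (c , p)) (inj₂ (¬c , q)) e =
      contradiction (next (X.trans (g.cong (Y.trans (Y.sym p) e)) q) c) ¬c
    match-injective (inj₂ (¬c , p)) (inj₁ (c , q)) e =
      contradiction (next (X.trans (g.cong (Y.sym (Y.trans e q))) p) c) ¬c
    match-injective (inj₂ (_ , p)) (inj₂ (_ , q)) e =
      X.trans (X.sym p) (X.trans (g.cong e) q)

    -- If `g y` is in a chain, it cannot start it, so it has the form `g (f x)`, and `y` is matched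
    -- with `x` by injectivity of `g`.
    match-surjective : ∀ y → ∃ λ x → Match x y
    match-surjective y with lem (Chain (g.to y))
    ... | no ¬c = g.to y , inj₂ (¬c , X.refl)
    ... | yes (start p) = contradiction X.refl (p y)
    ... | yes (next {x} q c) = x , inj₁ (c , Y.sym (g.injective q))

    schröderBernstein : X ≈ᶜ Y
    schröderBernstein = Bijection⇒Inverse record
      { to        = proj₁ ∘ match
      ; cong      = match-functional (proj₂ (match _)) (proj₂ (match _))
      ; bijective = match-injective (proj₂ (match _)) (proj₂ (match _)) , λ y →
          let x , m = match-surjective y in x , match-functional (proj₂ (match _)) m
      }

  module _ (X : Setoid ℓ ℓ) {K : Set ℓ} (i : X ≤ᶜ ≡.setoid K) (x₀ : Setoid.Carrier X) where
    open Setoid X using (Carrier; _≈_)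
    open Injection i

    retraction : K → Carrier
    retraction k with lem (∃ λ x → to x ≡ k)
    ... | yes (x , _) = x
    ... | no _        = x₀

    retraction-to : ∀ x → retraction (to x) ≈ x
    retraction-to x with lem (∃ λ x′ → to x′ ≡ to x)
    ... | yes (_ , p) = injective p
    ... | no ¬∃       = contradiction (x , refl) ¬∃

module _ (ac : AxiomOfChoice ℓ) where

  -- The type consists of the fixed points of the normal form function; uniqueness of identity
  -- proofs makes the fixed-point proofs irrelevant.
  canonical : (A : Setoid ℓ ℓ) → Σ (Set ℓ) λ K → ≡.setoid K ≈ᶜ A
  canonical A = Σ A.Carrier (λ x → nf x ≡ x) , record
    { to        = proj₁
    ; from      = λ x → nf x , sym (nf-cong (≈nf x))
    ; to-cong   = λ { refl → A.refl }
    ; from-cong = λ x≈y → Σ≡ (nf-cong x≈y)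
    ; inverse   = (λ { {x} refl → A.sym (≈nf x) })
                , (λ { {_ , p} y≈x → Σ≡ (trans (nf-cong y≈x) p) })
    }
    where
    module A = Setoid A
    nf      = proj₁ (normalForm ac A)
    ≈nf     = proj₁ (proj₂ (normalForm ac A))
    nf-cong : ∀ {x y} → x A.≈ y → nf x ≡ nf y
    nf-cong = proj₂ (proj₂ (normalForm ac A))
    Σ≡ : ∀ {x y} {p : nf x ≡ x} {q : nf y ≡ y} → x ≡ y → (x , p) ≡ (y , q)
    Σ≡ refl = cong (_ ,_) (≡-irrelevant _ _)

PowerClosed : Set ℓ → Set _
PowerClosed {ℓ} K = (M : Set ℓ) → ≡.setoid M ≤ᶜ ≡.setoid K → ¬ (≡.setoid M ≈ᶜ ≡.setoid K) →
  (≡.setoid M ⇨ ≡.setoid K) ≤ᶜ ≡.setoid K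

weakPowerFixed⇒powerClosed : ∀ {κ : Cardinal ℓ} {K : Set ℓ} → ≡.setoid K ≈ᶜ κ →
  IsWeakPowerFixed κ → PowerClosed K
weakPowerFixed⇒powerClosed {κ = κ} {K} K≈κ (bound , _) M M≤K M≉K = record
  { to        = λ g → from (to' (conv g))
  ; cong      = λ g≈h → from-cong (cong' λ x → to-cong (g≈h x))
  ; injective = λ eq x → to-injective (injective' (from-injective eq) x)
  }
  where
  open Inverse K≈κ
  module κ = Setoid κ
  to-injective : ∀ {x y} → to x κ.≈ to y → x ≡ y
  to-injective p = trans (sym (strictlyInverseʳ _)) (trans (from-cong p) (strictlyInverseʳ _))
  from-injective : ∀ {x y} → from x ≡ from y → x κ.≈ y
  from-injective p = κ.trans (κ.sym (strictlyInverseˡ _))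
    (κ.trans (κ.reflexive (cong to p)) (strictlyInverseˡ _))
  μ = ≡.setoid M
  μ<κ : μ <ᶜ κ
  μ<κ = Compose.injection M≤K record { to = to ; cong = to-cong ; injective = to-injective }
      , λ μ≈κ → M≉K (Inv.trans μ≈κ (Inv.sym K≈κ))
  open Injection (bound (κ ^ᶜ μ) (μ , μ<κ , Inv.refl _))
    renaming (to to to'; cong to cong'; injective to injective')
  conv : Func μ (≡.setoid K) → Func μ κ
  conv g = record { to = to ∘ Func.to g ; cong = λ { refl → κ.refl } }

-- Zermelo's argument with the least family of sets closed under step and unions
-- as an inductive predicate; Bool-valued subsets keep it at level ℓ.

module Tower (lem : (P : Set ℓ) → Dec P) {K : Set ℓ} where

  𝒫 : Set ℓ
  𝒫 = K → Bool

  ⟪_⟫ : (K → Set ℓ) → 𝒫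
  ⟪ P ⟫ x = isYes (lem (P x))

  infix 4 _∈ᵇ_ _⊆ᵇ_

  _∈ᵇ_ : K → 𝒫 → Set
  x ∈ᵇ S = T (S x)

  _⊆ᵇ_ : 𝒫 → 𝒫 → Set ℓ
  S ⊆ᵇ S′ = ∀ {x} → x ∈ᵇ S → x ∈ᵇ S′

  ⋃ᵇ : (𝒫 → Bool) → 𝒫
  ⋃ᵇ I = ⟪ (λ x → ∃ λ S → T (I S) × x ∈ᵇ S) ⟫

  module Stages (step : 𝒫 → 𝒫) (extensive : ∀ {S} → S ⊆ᵇ step S)
                (step-mono-≗ : ∀ {S S′} → S ⊆ᵇ S′ → S′ ⊆ᵇ S → step S ⊆ᵇ step S′) where

    data Stage : 𝒫 → Set ℓ where
      stage-step : ∀ {S} → Stage S → Stage (step S)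
      stage-⋃    : ∀ I → (∀ {S} → T (I S) → Stage S) → Stage (⋃ᵇ I)

    -- The extreme points from the proof of the Bourbaki-Witt theorem.
    Extreme : 𝒫 → Set ℓ
    Extreme C = ∀ {S} → Stage S → S ⊆ᵇ C → ¬ (C ⊆ᵇ S) → step S ⊆ᵇ C

    -- Induction on `S`. If `S` lies properly in `C`, extremality keeps `step S` in `C`; if both
    -- agree, so do their steps. A union lies in `C` unless one of its members contains `step C`.
    extreme-comparable : ∀ {C} → Extreme C → ∀ {S} → Stage S → S ⊆ᵇ C ⊎ step C ⊆ᵇ S
    extreme-comparable {C} ext (stage-step {S} s) with extreme-comparable ext s
    ... | inj₂ q = inj₂ (extensive {S} ∘ q)
    ... | inj₁ S⊆C with lem (C ⊆ᵇ S)
    ...   | yes C⊆S = inj₂ (step-mono-≗ C⊆S S⊆C)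
    ...   | no C⊈S = inj₁ (ext s S⊆C C⊈S)
    extreme-comparable {C} ext (stage-⋃ I stages) with lem (∃ λ S → T (I S) × step C ⊆ᵇ S)
    ... | yes (S , i , q) = inj₂ λ x∈ → fromWitness (S , i , q x∈)
    ... | no ¬∃ = inj₁ λ x∈ → let S , i , x∈S = toWitness x∈ in
      [ (λ S⊆C → S⊆C x∈S) , (λ q → contradiction (S , i , λ {x} → q {x}) ¬∃) ]
      (extreme-comparable ext (stages i))

    -- Induction on `C`, comparing `S` with the previous stage or, for a union, with a member not
    -- contained in `S`. The other outcome of the comparison would put the whole step, or that
    -- member, inside `S`.
    extreme : ∀ {C} → Stage C → Extreme C
    extreme (stage-step {C} c) s S⊆ ⊈S with extreme-comparable (extreme c) s
    ... | inj₂ q = contradiction (λ {x} → q {x}) ⊈S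
    ... | inj₁ S⊆C with lem (C ⊆ᵇ _)
    ...   | yes C⊆S = step-mono-≗ S⊆C C⊆S
    ...   | no C⊈S = extensive {C} ∘ extreme c s S⊆C C⊈S
    extreme (stage-⋃ I stages) {S} s S⊆ ⊈S with lem (∃ λ C → T (I C) × ¬ (C ⊆ᵇ S))
    ... | no ¬∃ = ⊥-elim (⊈S λ {x} x∈ → let C , i , x∈C = toWitness x∈ in
        case T? (S x) of λ where
          (yes x∈S) → x∈S
          (no x∉S)  → contradiction (C , i , λ C⊆S → x∉S (C⊆S x∈C)) ¬∃)
    ... | yes (C , i , C⊈S) with extreme-comparable (extreme (stages i)) s
    ...   | inj₂ q = contradiction (λ {x} x∈C → q {x} (extensive {C} x∈C)) C⊈S
    ...   | inj₁ S⊆C = λ x∈ → fromWitness (C , i , extreme (stages i) s S⊆C C⊈S x∈)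

    comparable : ∀ {C S} → Stage C → Stage S → S ⊆ᵇ C ⊎ step C ⊆ᵇ S
    comparable c = extreme-comparable (extreme c)

    -- Once `S` is inside `C`, either they agree and `step` leads nowhere new, or `C` is strictly
    -- larger and extremality applies.
    fixed-maximal : ∀ {C S} → Stage C → step C ⊆ᵇ C → Stage S → S ⊆ᵇ C
    fixed-maximal {C} c fix (stage-step {S} s) with fixed-maximal c fix s | lem (C ⊆ᵇ S)
    ... | S⊆C | yes C⊆S = fix ∘ step-mono-≗ S⊆C C⊆S
    ... | S⊆C | no C⊈S  = extreme c s S⊆C C⊈S
    fixed-maximal c fix (stage-⋃ I stages) x∈ =
      let S , i , x∈S = toWitness x∈ in fixed-maximal c fix (stages i) x∈S

    top : 𝒫
    top = ⋃ᵇ λ S → isYes (lem (Stage S))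

    top-stage : Stage top
    top-stage = stage-⋃ _ toWitness

    -- The largest stage without `x`; its elements will be the predecessors of `x`.
    below : K → 𝒫
    below x = ⋃ᵇ λ S → isYes (lem (Stage S × ¬ (x ∈ᵇ S)))

    below-stage : ∀ x → Stage (below x)
    below-stage x = stage-⋃ _ (proj₁ ∘ toWitness)

    ∉-below : ∀ x → ¬ (x ∈ᵇ below x)
    ∉-below x x∈ = let S , i , x∈S = toWitness x∈ in proj₂ (toWitness i) x∈S

    ∉⇒⊆below : ∀ {x S} → Stage S → ¬ (x ∈ᵇ S) → S ⊆ᵇ below x
    ∉⇒⊆below {S = S} s x∉S y∈S = fromWitness (S , fromWitness (s , x∉S) , y∈S)

    ⊆top : ∀ {S} → Stage S → S ⊆ᵇ top
    ⊆top {S} s x∈S = fromWitness (S , fromWitness s , x∈S)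

    -- Otherwise `step (below x)` is a stage without `x`, so `below x` is fixed and contains `top`,
    -- hence `x`.
    ∈-step-below : ∀ {x} → x ∈ᵇ top → x ∈ᵇ step (below x)
    ∈-step-below {x} x∈ with T? (step (below x) x)
    ... | yes p = p
    ... | no x∉ = contradiction
      (fixed-maximal (below-stage x) (∉⇒⊆below (stage-step (below-stage x)) x∉) top-stage x∈)
      (∉-below x)

    -- If `below y` is not inside `below z`, it contains `step (below z)` and with it `y` itself.
    below-trans : ∀ {x y z} → x ∈ᵇ below y → y ∈ᵇ below z → x ∈ᵇ below z
    below-trans {x} {y} {z} x∈ y∈ with comparable (below-stage z) (below-stage y)
    ... | inj₁ p = p x∈
    ... | inj₂ p = contradiction (p (extensive {below z} y∈)) (∉-below y)

-- A linear order with short initial segments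

T-Σ≡ : {S : A → Bool} {p q : Σ A (T ∘ S)} → proj₁ p ≡ proj₁ q → p ≡ q
T-Σ≡ refl = cong (_ ,_) (Bool.T-irrelevant _ _)

-- `L` is only equinumerous with `K`: the tower stops once it has κ elements, perhaps before `K` is
-- exhausted.
record Order (K : Set ℓ) : Set (Level.suc ℓ) where
  infix 4 _≺_
  field
    L       : Set ℓ
    L≈K     : ≡.setoid L ≈ᶜ ≡.setoid K
    _≺ᵇ_    : L → L → Bool

  _≺_ : L → L → Set
  x ≺ y = T (x ≺ᵇ y)

  field
    compare : ∀ x y → x ≡ y ⊎ x ≺ y ⊎ y ≺ x
    ≺-trans : ∀ {x y z} → x ≺ y → y ≺ z → x ≺ z

Short : {K : Set ℓ} → Order K → Set ℓ
Short {K = K} order = ∀ x → ¬ (≡.setoid (∃ (_≺ x)) ≈ᶜ ≡.setoid K)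
  where open Order order

shortOrder : ((P : Set ℓ) → Dec P) → ((A : Setoid ℓ ℓ) → NormalForm A) →
  (K : Set ℓ) → Σ (Order K) Short
shortOrder {ℓ} lem normalForm K = record
  { L       = L
  ; L≈K     = decidable-stable (lem _) top-not-small
  ; _≺ᵇ_    = λ (x , _) (y , _) → nf (below y) x
  ; compare = compare
  ; ≺-trans = λ x≺y y≺z → ⊆nf _ (below-trans (nf⊆ _ x≺y) (nf⊆ _ y≺z))
  } , short
  where
  open Tower lem {K}

  𝒫-setoid : Setoid ℓ ℓ
  𝒫-setoid = record
    { Carrier = 𝒫
    ; _≈_ = λ S S′ → ∀ x → S x ≡ S′ x
    ; isEquivalence = record
      { refl  = λ _ → refl
      ; sym   = λ p x → sym (p x)
      ; trans = λ p q x → trans (p x) (q x)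
      }
    }

  -- The element chosen by `fresh` may depend on the function that represents the subset;
  -- normalising first makes `step` respect equality of subsets.
  nf : 𝒫 → 𝒫
  nf = proj₁ (normalForm 𝒫-setoid)

  ≈nf : ∀ S x → S x ≡ nf S x
  ≈nf = proj₁ (proj₂ (normalForm 𝒫-setoid))

  ⊆nf : ∀ S → S ⊆ᵇ nf S
  ⊆nf S {x} = subst T (≈nf S x)

  nf⊆ : ∀ S → nf S ⊆ᵇ S
  nf⊆ S {x} = subst T (sym (≈nf S x))

  ⊆-antisym : ∀ {S S′} → S ⊆ᵇ S′ → S′ ⊆ᵇ S → ∀ x → S x ≡ S′ x
  ⊆-antisym {S} {S′} p q x with S x | S′ x | p {x} | q {x}
  ... | false | false | _ | _  = refl
  ... | true  | true  | _ | _  = refl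
  ... | true  | false | p′ | _ = ⊥-elim (p′ _)
  ... | false | true  | _ | q′ = ⊥-elim (q′ _)

  nf-ext : ∀ {S S′} → S ⊆ᵇ S′ → S′ ⊆ᵇ S → nf S ≡ nf S′
  nf-ext p q = proj₂ (proj₂ (normalForm 𝒫-setoid)) (⊆-antisym p q)

  Small : 𝒫 → Set ℓ
  Small S = ¬ (≡.setoid (∃ (_∈ᵇ S)) ≈ᶜ ≡.setoid K)

  fresh : ∀ {S} → Small S → ∃ λ x → ¬ (x ∈ᵇ S)
  fresh {S} small with lem (∃ λ x → ¬ (x ∈ᵇ S))
  ... | yes p = p
  ... | no ¬∃ = ⊥-elim (small record
    { to        = proj₁
    ; from      = λ x → x , all x
    ; to-cong   = cong proj₁
    ; from-cong = λ { refl → refl }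
    ; inverse   = (λ { refl → refl }) , λ { refl → T-Σ≡ refl }
    })
    where
    all : ∀ x → x ∈ᵇ S
    all x = decidable-stable (T? (S x)) λ x∉S → ¬∃ (x , x∉S)

  -- Growth stops at cardinality κ, so each element is added to a set smaller than κ. This makes the
  -- initial segments short.
  grow : 𝒫 → 𝒫
  grow S with lem (Small S)
  ... | yes small = ⟪ (λ x → x ∈ᵇ S ⊎ x ≡ proj₁ (fresh small)) ⟫
  ... | no _      = S

  ⊆grow : ∀ {S} → S ⊆ᵇ grow S
  ⊆grow {S} x∈S with lem (Small S)
  ... | yes small = fromWitness (inj₁ x∈S)
  ... | no _      = x∈S

  grow-new : ∀ {S x y} → x ∈ᵇ grow S → y ∈ᵇ grow S → ¬ (x ∈ᵇ S) → ¬ (y ∈ᵇ S) → x ≡ y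
  grow-new {S} x∈ y∈ x∉ y∉ with lem (Small S)
  ... | no _      = contradiction x∈ x∉
  ... | yes small with toWitness x∈ | toWitness y∈
  ...   | inj₁ x∈S | _        = contradiction x∈S x∉
  ...   | inj₂ _   | inj₁ y∈S = contradiction y∈S y∉
  ...   | inj₂ p   | inj₂ q   = trans p (sym q)

  grow-small : ∀ {S x} → x ∈ᵇ grow S → ¬ (x ∈ᵇ S) → Small S
  grow-small {S} x∈ x∉ with lem (Small S)
  ... | no _      = contradiction x∈ x∉
  ... | yes small = small

  grow-proper : ∀ {S} → Small S → ¬ (grow S ⊆ᵇ S)
  grow-proper {S} small p with lem (Small S)
  ... | no ¬small = ¬small small
  ... | yes small = proj₂ (fresh small) (p (fromWitness (inj₂ refl)))

  step : 𝒫 → 𝒫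
  step S = grow (nf S)

  extensive : ∀ {S} → S ⊆ᵇ step S
  extensive {S} = ⊆grow {nf S} ∘ ⊆nf S

  step-mono-≗ : ∀ {S S′} → S ⊆ᵇ S′ → S′ ⊆ᵇ S → step S ⊆ᵇ step S′
  step-mono-≗ p q {x} = subst (λ S → x ∈ᵇ grow S) (nf-ext p q)

  open Stages step (λ {S} → extensive {S}) step-mono-≗

  L : Set ℓ
  L = ∃ (_∈ᵇ nf top)

  ∈-grow-below : ((x , _) : L) → x ∈ᵇ grow (nf (below x))
  ∈-grow-below (x , p) = ∈-step-below (nf⊆ top p)

  ∉-nf-below : ∀ x → ¬ (x ∈ᵇ nf (below x))
  ∉-nf-below x = ∉-below x ∘ nf⊆ (below x)

  -- A small `top` would grow, but `step top` is again a stage and lies in `top`.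
  top-not-small : ¬ Small (nf top)
  top-not-small small = grow-proper small λ x∈ →
    ⊆nf top (⊆top (stage-step top-stage) x∈)

  short : ((x , p) : L) → ¬ (≡.setoid (Σ L λ (y , _) → y ∈ᵇ nf (below x)) ≈ᶜ ≡.setoid K)
  short (x , p) L≺x≈K = grow-small (∈-grow-below (x , p)) (∉-nf-below x)
    (Inv.trans record
      { to        = λ (y , y≺x) →
          (y , ⊆nf top (⊆top (below-stage x) (nf⊆ (below x) y≺x))) , y≺x
      ; from      = λ ((y , _) , y≺x) → y , y≺x
      ; to-cong   = λ { refl → refl }
      ; from-cong = λ { refl → refl }
      ; inverse   = (λ { refl → T-Σ≡ (T-Σ≡ refl) }) , λ { refl → refl }
      } L≺x≈K)

  -- If neither precedes the other, both have the same predecessors, so both are added in the same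
  -- step, which adds a single element.
  compare : ∀ (x y : L) → x ≡ y ⊎ proj₁ x ∈ᵇ nf (below (proj₁ y)) ⊎ proj₁ y ∈ᵇ nf (below (proj₁ x))
  compare (x , p) (y , q) with T? (nf (below y) x) | T? (nf (below x) y)
  ... | yes x≺y | _       = inj₂ (inj₁ x≺y)
  ... | no _    | yes y≺x = inj₂ (inj₂ y≺x)
  ... | no x⊀y  | no y⊀x  = inj₁ (T-Σ≡ (grow-new (∈-grow-below (x , p))
      (subst (λ S → y ∈ᵇ grow S) (sym same) (∈-grow-below (y , q))) (∉-nf-below x)
      (subst (λ S → ¬ (y ∈ᵇ S)) (sym same) (∉-nf-below y))))
    where
    ⊆below : ∀ z z′ → ¬ (z ∈ᵇ nf (below z′)) → below z′ ⊆ᵇ below z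
    ⊆below z z′ z⊀z′ = ∉⇒⊆below (below-stage z′) (z⊀z′ ∘ ⊆nf (below z′))
    same : nf (below x) ≡ nf (below y)
    same = nf-ext (⊆below y x y⊀x) (⊆below x y x⊀y)

-- Predictions

-- What a prediction has to know of a group: `Rank s n` stands for the elements indexed by `s`
-- generating a subgroup in `𝒱 n`.
record Ranking (A : Set ℓ) : Set (Level.suc ℓ) where
  field
    Rank     : List A → ℕ → Set ℓ
    antitone : ∀ {s t n} → s Subset.⊆ t → Rank t n → Rank s n
    monotone : ∀ {s m n} → m ≤ n → Rank s m → Rank s n
    total    : ∀ s → ∃ (Rank s)
    []-rank  : ∀ n → Rank [] n

-- In `guess` the code `c` may depend on the ranking and on `x`, but not on `t`; `predict` is
-- independent of the ranking and so serves all groups at once.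
record Prediction (K : Set ℓ) : Set (Level.suc ℓ) where
  field
    order   : Order K
  open Order order public
  field
    predict : L → K → List L → ℕ
    guess   : (R : Ranking L) → let open Ranking R in
      ∀ x → ∃ λ c → ∀ t → All (_≺ x) t → Rank (x ∷ t) (predict x c t)

  maximum : ∀ y t → ∃ λ z → z ∈ (y ∷ t) × (∀ {w} → w ∈ (y ∷ t) → w ≡ z ⊎ w ≺ z)
  maximum y [] = y , here refl , λ { (here p) → inj₁ p }
  maximum y (y′ ∷ t) with maximum y′ t
  ... | z , z∈ , max with compare y z
  ...   | inj₁ y≡z        = z , there z∈ , λ { (here refl) → inj₁ y≡z ; (there w∈) → max w∈ }
  ...   | inj₂ (inj₁ y≺z) = z , there z∈ , λ { (here refl) → inj₂ y≺z ; (there w∈) → max w∈ }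
  ...   | inj₂ (inj₂ z≺y) = y , here refl , λ where
    (here p)   → inj₁ p
    (there w∈) → inj₂ ([ (λ { refl → z≺y }) , (λ w≺z → ≺-trans w≺z z≺y) ] (max w∈))

  earlier : L → List (L × K) → List L
  earlier x s = filter (λ y → T? (y ≺ᵇ x)) (map proj₁ s)

  rank : List (L × K) → ℕ
  rank s = max 0 (map (λ (x , c) → predict x c (earlier x s)) s)

  module _ (R : Ranking L) where
    open Ranking R

    branch : L → K
    branch x = proj₁ (guess R x)

    -- The correct prediction at the largest element z of t already bounds the rank
    -- of a list containing t, so wrong predictions in s do no harm.
    rank-bounds : ∀ s t → (∀ {x} → x ∈ t → (x , branch x) ∈ s) → Rank t (rank s)
    rank-bounds s [] _ = []-rank _
    rank-bounds s (y ∷ t) onBranch with maximum y t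
    ... | z , z∈ , max = antitone
      (λ w∈ → [ (λ { refl → here refl })
              , (λ w≺z → there (∈-filter⁺ (λ y → T? (y ≺ᵇ z)) (∈-map⁺ proj₁ (onBranch w∈)) w≺z))
              ] (max w∈))
      (monotone (lookup (xs≤max 0 _) (∈-map⁺ _ (onBranch z∈)))
        (proj₂ (guess R z) (earlier z s) (All.all-filter _ (map proj₁ s))))

-- Codes in `K` for functions, pairs and predictions

module _ {K : Set ℓ} (lem : (P : Set ℓ) → Dec P) (closed : PowerClosed K)
         (ι : ℕ → K) (ι-injective : ∀ {m n} → ι m ≡ ι n → m ≡ n) where

  open Classical lem

  module _ {M : Set ℓ} (M≤K : ≡.setoid M ≤ᶜ ≡.setoid K) (M≉K : ¬ (≡.setoid M ≈ᶜ ≡.setoid K)) where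

    private
      μ→K = ≡.setoid M ⇨ ≡.setoid K
      i = closed M M≤K M≉K
      const : Func (≡.setoid M) (≡.setoid K)
      const = record { to = λ _ → ι 0 ; cong = λ _ → refl }

    -- Total on `K`: elements that code no function decode to a constant one.
    decode : K → M → K
    decode c = Func.to (retraction μ→K i const c)

    encode : (M → K) → K
    encode g = Injection.to i record { to = g ; cong = cong g }

    decode-encode : ∀ g m → decode (encode g) m ≡ g m
    decode-encode g = retraction-to μ→K i const _

  ℕ↓ : K → ℕ
  ℕ↓ k with lem (∃ λ n → ι n ≡ k)
  ... | yes (n , _) = n
  ... | no _        = 0

  ℕ↓-ι : ∀ n → ℕ↓ (ι n) ≡ n
  ℕ↓-ι n with lem (∃ λ m → ι m ≡ ι n)
  ... | yes (_ , p) = ι-injective p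
  ... | no ¬∃       = contradiction (n , refl) ¬∃

  2≤K : ≡.setoid (Lift ℓ Bool) ≤ᶜ ≡.setoid K
  2≤K = record
    { to        = λ b → ι (if lower b then 1 else 0)
    ; cong      = λ { refl → refl }
    ; injective = λ {b} {b′} p → cong lift (inj (lower b) (lower b′) (ι-injective p))
    }
    where
    inj : ∀ b b′ → (if b then 1 else 0) ≡ (if b′ then 1 else 0) → b ≡ b′
    inj true  true  _ = refl
    inj false false _ = refl

  2≉K : ¬ (≡.setoid (Lift ℓ Bool) ≈ᶜ ≡.setoid K)
  2≉K 2≈K = pigeonhole (g 0) (g 1) (g 2)
      (λ p → case g-injective p of λ ()) (λ p → case g-injective p of λ ())
      (λ p → case g-injective p of λ ())
    where
    open Inverse 2≈K
    g : ℕ → Bool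
    g n = lower (from (ι n))
    g-injective : ∀ {m n} → g m ≡ g n → m ≡ n
    g-injective p = ι-injective
      (trans (sym (strictlyInverseˡ _)) (trans (cong (to ∘ lift) p) (strictlyInverseˡ _)))
    pigeonhole : ∀ (x y z : Bool) → ¬ (x ≡ y) → ¬ (x ≡ z) → ¬ (y ≡ z) → ⊥
    pigeonhole true  true  _     p _ _ = p refl
    pigeonhole true  false true  _ q _ = q refl
    pigeonhole true  false false _ _ r = r refl
    pigeonhole false true  true  _ _ r = r refl
    pigeonhole false true  false _ q _ = q refl
    pigeonhole false false _     p _ _ = p refl

  -- A pair is a function on a two-element set, so κ · κ ≤ κ is the case μ = 2 of κ^μ ≤ κ.
  pair : K → K → K
  pair x y = encode 2≤K 2≉K λ b → if lower b then x else y

  pair-injective : ∀ {x y x′ y′} → pair x y ≡ pair x′ y′ → x ≡ x′ × y ≡ y′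
  pair-injective p = component (lift true) , component (lift false)
    where
    component : ∀ b → _
    component b = trans (sym (decode-encode 2≤K 2≉K _ b))
      (trans (cong (λ c → decode 2≤K 2≉K c b) p) (decode-encode 2≤K 2≉K _ b))

  -- Initial segments are finite here, so that a single number bounds the ranks of
  -- all lists below x.

  countablePrediction : ≡.setoid (Lift ℓ ℕ) ≈ᶜ ≡.setoid K → Prediction K
  countablePrediction ℕ≈K = record
    { order   = record
      { L       = K
      ; L≈K     = Inv.refl _
      ; _≺ᵇ_    = λ x y → index x <ᵇ index y
      ; compare = compare
      ; ≺-trans = λ {x} {y} {z} p q → ℕ.<⇒<ᵇ
          (ℕ.<-trans (ℕ.<ᵇ⇒< (index x) (index y) p) (ℕ.<ᵇ⇒< (index y) (index z) q))
      }
    ; predict = λ _ c _ → index c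
    ; guess   = guess
    }
    where
    open Inverse ℕ≈K
    index : K → ℕ
    index k = lower (from k)
    unindex : ℕ → K
    unindex n = to (lift n)
    compare : ∀ x y → x ≡ y ⊎ T (index x <ᵇ index y) ⊎ T (index y <ᵇ index x)
    compare x y with ℕ.<-cmp (index x) (index y)
    ... | tri< p _ _ = inj₂ (inj₁ (ℕ.<⇒<ᵇ p))
    ... | tri> _ _ p = inj₂ (inj₂ (ℕ.<⇒<ᵇ p))
    ... | tri≈ _ p _ = inj₁
      (trans (sym (strictlyInverseˡ _)) (trans (cong unindex p) (strictlyInverseˡ _)))
    guess : (R : Ranking K) → let open Ranking R in
      ∀ x → ∃ λ c → ∀ t → All (λ y → T (index y <ᵇ index x)) t → Rank (x ∷ t) (index c)
    guess R x = unindex (proj₁ bound) , λ t t≺x → antitone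
        (λ { (here refl) → here refl
           ; (there y∈) → there (subst (_∈ initial) (strictlyInverseˡ _)
               (∈-map⁺ unindex (∈-upTo⁺ (ℕ.<ᵇ⇒< _ _ (lookup t≺x y∈))))) })
        (subst (Rank _) (sym (cong lower (strictlyInverseʳ _))) (proj₂ bound))
      where
      open Ranking R
      initial = map unindex (upTo (index x))
      bound = total (x ∷ initial)

  module _ (ℕ≉K : ¬ (≡.setoid (Lift ℓ ℕ) ≈ᶜ ≡.setoid K)) (order : Order K) (short : Short order) where

    open Order order

    private
      ℕ≤K : ≡.setoid (Lift ℓ ℕ) ≤ᶜ ≡.setoid K
      ℕ≤K = record
        { to = ι ∘ lower ; cong = cong (ι ∘ lower) ; injective = cong lift ∘ ι-injective }

      segment≤K : ∀ x → ≡.setoid (∃ (_≺ x)) ≤ᶜ ≡.setoid K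
      segment≤K x = record
        { to        = to ∘ proj₁
        ; cong      = cong (to ∘ proj₁)
        ; injective = λ p → T-Σ≡
            (trans (sym (strictlyInverseʳ _)) (trans (cong from p) (strictlyInverseʳ _)))
        }
        where open Inverse L≈K

    -- Defined on all of `L` so that lists carry no proofs; the value outside the segment below `x`
    -- is arbitrary.
    apply : L → K → L → K
    apply x c y with T? (y ≺ᵇ x)
    ... | yes y≺x = decode (segment≤K x) (short x) c (y , y≺x)
    ... | no _    = c

    abstraction : L → (L → K) → K
    abstraction x g = encode (segment≤K x) (short x) (g ∘ proj₁)

    apply-abstraction : ∀ {x} g {y} → y ≺ x → apply x (abstraction x g) y ≡ g y
    apply-abstraction {x} g {y} y≺x with T? (y ≺ᵇ x)
    ... | yes _  = decode-encode (segment≤K x) (short x) _ _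
    ... | no y⊀x = contradiction y≺x y⊀x

    -- K^(Sⁿ) ≤ K for an initial segment S, by currying.

    applyList : L → ℕ → K → List L → K
    applyList x (suc n) c (y ∷ t) = applyList x n (apply x c y) t
    applyList x _       c _       = c

    abstractionList : L → ℕ → (List L → K) → K
    abstractionList x zero    v = v []
    abstractionList x (suc n) v = abstraction x λ y → abstractionList x n (v ∘ (y ∷_))

    applyList-abstractionList : ∀ {x} v {t} → All (_≺ x) t →
      applyList x (length t) (abstractionList x (length t) v) t ≡ v t
    applyList-abstractionList v [] = refl
    applyList-abstractionList {x} v {y ∷ t} (y≺x ∷ t≺x) = trans
      (cong (λ c → applyList x (length t) c t) (apply-abstraction _ y≺x))
      (applyList-abstractionList (v ∘ (y ∷_)) t≺x)

    -- A code is read as a sequence, which is possible since ℵ₀ < κ; its entry at the length of `t`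
    -- codes a function of that many arguments below `x`.
    uncountablePrediction : Prediction K
    uncountablePrediction = record
      { order   = order
      ; predict = λ x c t → ℕ↓ (applyList x (length t) (decode ℕ≤K ℕ≉K c (lift (length t))) t)
      ; guess   = guess
      }
      where
      guess : (R : Ranking L) → let open Ranking R in
        ∀ x → ∃ λ c → ∀ t → All (_≺ x) t →
          Rank (x ∷ t) (ℕ↓ (applyList x (length t) (decode ℕ≤K ℕ≉K c (lift (length t))) t))
      guess R x = encode ℕ≤K ℕ≉K (λ n → abstractionList x (lower n) v) , λ t t≺x →
        subst (Rank (x ∷ t))
          (sym (trans
            (cong ℕ↓ (trans
              (cong (λ c → applyList x (length t) c t) (decode-encode ℕ≤K ℕ≉K _ _))
              (applyList-abstractionList v t≺x)))
            (ℕ↓-ι _)))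
          (proj₂ (total (x ∷ t)))
        where
        open Ranking R
        v : List L → K
        v t = ι (proj₁ (total (x ∷ t)))

  -- Sequences can be coded only if ℵ₀ < κ; hence the separate treatment of κ = ℵ₀.
  prediction : Σ (Order K) Short → Prediction K
  prediction (order , short) with lem (≡.setoid (Lift ℓ ℕ) ≈ᶜ ≡.setoid K)
  ... | yes ℕ≈K = countablePrediction ℕ≈K
  ... | no ℕ≉K  = uncountablePrediction ℕ≉K order short

-- Groups presented by laws on finitely generated subgroups

module _ (G : Group ℓ ℓ) where
  open Group G using (Carrier; _≈_; _∙_; ε; _⁻¹; ∙-cong; ⁻¹-cong; identityˡ)

  ⟦⟧-cong : ∀ t {ρ ρ′} → (∀ i → ρ i ≈ ρ′ i) → ⟦_⟧ G t ρ ≈ ⟦_⟧ G t ρ′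
  ⟦⟧-cong (var i)  p = p i
  ⟦⟧-cong ε′       p = Group.refl G
  ⟦⟧-cong (s ∙′ t) p = ∙-cong (⟦⟧-cong s p) (⟦⟧-cong t p)
  ⟦⟧-cong (t ⁻¹′)  p = ⁻¹-cong (⟦⟧-cong t p)

  ⟦⟧-subgroup : ∀ H t ρ → proj₁ (⟦_⟧ (Subgroup.group {G = G} H) t ρ) ≡ ⟦_⟧ G t (proj₁ ∘ ρ)
  ⟦⟧-subgroup H (var i)  ρ = refl
  ⟦⟧-subgroup H ε′       ρ = refl
  ⟦⟧-subgroup H (s ∙′ t) ρ = cong₂ _∙_ (⟦⟧-subgroup H s ρ) (⟦⟧-subgroup H t ρ)
  ⟦⟧-subgroup H (t ⁻¹′)  ρ = cong _⁻¹ (⟦⟧-subgroup H t ρ)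

  SatisfiesOn : (Carrier → Set ℓ) → Identity → Set ℓ
  SatisfiesOn P (l , r) = ∀ ρ → (∀ i → P (ρ i)) → ⟦_⟧ G l ρ ≈ ⟦_⟧ G r ρ

  satisfies⇔ : ∀ (H : Subgroup G) e →
    Satisfies (Subgroup.group H) e ⇔ SatisfiesOn (Subgroup.member H) e
  satisfies⇔ H (l , r) = mk⇔
    (λ sat ρ ρ∈ → let σ = λ i → ρ i , ρ∈ i in
      subst₂ _≈_ (⟦⟧-subgroup H l σ) (⟦⟧-subgroup H r σ) (sat σ))
    (λ sat σ → subst₂ _≈_ (sym (⟦⟧-subgroup H l σ)) (sym (⟦⟧-subgroup H r σ))
      (sat (proj₁ ∘ σ) (proj₂ ∘ σ)))

  ⟨_⟩ : List Carrier → Subgroup G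
  ⟨ xs ⟩ = record
    { member = Generated G xs
    ; resp   = resp
    ; ε-mem  = ε-mem
    ; ∙-mem  = ∙-mem
    ; ⁻¹-mem = ⁻¹-mem
    }

  -- The generated subgroup is the least one. Besides subgroups, `P` will also be the property of
  -- being equivalent to a word over a given list.
  Generated-⊆ : ∀ {xs} {P : Carrier → Set ℓ} →
    (∀ {x y} → x ≈ y → P x → P y) → P ε → (∀ {x y} → P x → P y → P (x ∙ y)) →
    (∀ {x} → P x → P (x ⁻¹)) → All P xs → ∀ {x} → Generated G xs x → P x
  Generated-⊆ {P = P} P-resp Pε P∙ P⁻¹ = go
    where
    member : ∀ {xs x} → Any (x ≈_) xs → All P xs → P x
    member (here x≈y) (Py ∷ _)  = P-resp (Group.sym G x≈y) Py
    member (there x∈) (_ ∷ Pxs) = member x∈ Pxs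
    go : ∀ {xs} → All P xs → ∀ {x} → Generated G xs x → P x
    go Pxs (gen x∈)     = member x∈ Pxs
    go Pxs (resp x≈y p) = P-resp x≈y (go Pxs p)
    go Pxs ε-mem        = Pε
    go Pxs (∙-mem p q)  = P∙ (go Pxs p) (go Pxs q)
    go Pxs (⁻¹-mem p)   = P⁻¹ (go Pxs p)

  Generated-mono : ∀ {xs ys} → All (Generated G ys) xs → ∀ {x} → Generated G xs x → Generated G ys x
  Generated-mono = Generated-⊆ resp ε-mem ∙-mem ⁻¹-mem

  ⟦⟧-trivial : ∀ t {ρ} → (∀ i → ρ i ≈ ε) → ⟦_⟧ G t ρ ≈ ε
  ⟦⟧-trivial (var i)  p = p i
  ⟦⟧-trivial ε′       p = Group.refl G
  ⟦⟧-trivial (s ∙′ t) p =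
    Group.trans G (∙-cong (⟦⟧-trivial s p) (⟦⟧-trivial t p)) (identityˡ ε)
  ⟦⟧-trivial (t ⁻¹′)  p =
    Group.trans G (⁻¹-cong (⟦⟧-trivial t p)) (GroupProperties.ε⁻¹≈ε G)

  Generated[]-trivial : ∀ {x} → Generated G [] x → x ≈ ε
  Generated[]-trivial = Generated-⊆
    (λ x≈y x≈ε → Group.trans G (Group.sym G x≈y) x≈ε) (Group.refl G)
    (λ p q → Group.trans G (∙-cong p q) (identityˡ ε))
    (λ p → Group.trans G (⁻¹-cong p) (GroupProperties.ε⁻¹≈ε G)) []

module Varieties {𝒱 : ℕ → GroupClass ℓ ℓ} (variety : ∀ n → IsVariety (𝒱 n)) where

  E : ℕ → Pred Identity ℓ
  E n = proj₁ (variety n)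

  subgroup-variety : ∀ n {G} (H : Subgroup G) →
    𝒱 n (Subgroup.group H) ⇔ (∀ e → E n e → SatisfiesOn G (Subgroup.member H) e)
  subgroup-variety n {G} H = mk⇔
    (λ v e Ee → Equivalence.to (satisfies⇔ G H e) (Equivalence.to (proj₂ (variety n) _) v e Ee))
    (λ sat → Equivalence.from (proj₂ (variety n) _)
      λ e Ee → Equivalence.from (satisfies⇔ G H e) (sat e Ee))

  subgroup-antitone : ∀ n {G} {H H′ : Subgroup G} →
    (∀ {x} → Subgroup.member H′ x → Subgroup.member H x) →
    𝒱 n (Subgroup.group H) → 𝒱 n (Subgroup.group H′)
  subgroup-antitone n {G} {H} {H′} H′⊆H v = Equivalence.from (subgroup-variety n H′)
    λ e Ee ρ ρ∈ → Equivalence.to (subgroup-variety n H) v e Ee ρ (H′⊆H ∘ ρ∈)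

  -- The empty list generates the trivial group, where both sides of an identity are `ε`.
  trivial-variety : ∀ n (G : Group ℓ ℓ) → 𝒱 n (Subgroup.group (⟨_⟩ G []))
  trivial-variety n G = Equivalence.from (subgroup-variety n (⟨_⟩ G []))
    λ (l , r) _ ρ ρ∈ → Group.trans G
      (⟦⟧-trivial G l (Generated[]-trivial G ∘ ρ∈))
      (Group.sym G (⟦⟧-trivial G r (Generated[]-trivial G ∘ ρ∈)))

-- Words and the universal property of the presented group

data Word (A : Set ℓ) : Set ℓ where
  letter : A → Word A
  ε      : Word A
  _∙_    : Word A → Word A → Word A
  _⁻¹    : Word A → Word A

module Presented {A : Set ℓ} (E : ℕ → Pred Identity ℓ) (f : List A → ℕ) where

  Over : List A → Word A → Set ℓ
  Over s (letter a) = a ∈ s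
  Over s ε          = ⊤
  Over s (v ∙ w)    = Over s v × Over s w
  Over s (w ⁻¹)     = Over s w

  substitute : Term → (ℕ → Word A) → Word A
  substitute (var i)  ρ = ρ i
  substitute ε′       ρ = ε
  substitute (s ∙′ t) ρ = substitute s ρ ∙ substitute t ρ
  substitute (t ⁻¹′)  ρ = substitute t ρ ⁻¹

  infix 4 _~_
  -- `law` asks for words written literally over `s`; `Generated⇒Over` replaces the elements of a
  -- generated subgroup by such words.
  data _~_ : Word A → Word A → Set ℓ where
    ~-refl    : ∀ {u} → u ~ u
    ~-sym     : ∀ {u v} → u ~ v → v ~ u
    ~-trans   : ∀ {u v w} → u ~ v → v ~ w → u ~ w
    ∙-cong    : ∀ {u u′ v v′} → u ~ u′ → v ~ v′ → (u ∙ v) ~ (u′ ∙ v′)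
    ⁻¹-cong   : ∀ {u u′} → u ~ u′ → (u ⁻¹) ~ (u′ ⁻¹)
    assoc     : ∀ u v w → ((u ∙ v) ∙ w) ~ (u ∙ (v ∙ w))
    identityˡ : ∀ u → (ε ∙ u) ~ u
    identityʳ : ∀ u → (u ∙ ε) ~ u
    inverseˡ  : ∀ u → ((u ⁻¹) ∙ u) ~ ε
    inverseʳ  : ∀ u → (u ∙ (u ⁻¹)) ~ ε
    law       : ∀ s {l r} → E (f s) (l , r) → ∀ ρ → (∀ i → Over s (ρ i)) →
                substitute l ρ ~ substitute r ρ

  group : Group ℓ ℓ
  group = record
    { Carrier = Word A
    ; _≈_     = _~_
    ; _∙_     = _∙_
    ; ε       = ε
    ; _⁻¹     = _⁻¹
    ; isGroup = record
      { isMonoid = record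
        { isSemigroup = record
          { isMagma = record
            { isEquivalence = record { refl = ~-refl ; sym = ~-sym ; trans = ~-trans }
            ; ∙-cong        = ∙-cong
            }
          ; assoc = assoc
          }
        ; identity = identityˡ , identityʳ
        }
      ; inverse = inverseˡ , inverseʳ
      ; ⁻¹-cong = ⁻¹-cong
      }
    }

  ⟦⟧-substitute : ∀ t ρ → ⟦_⟧ group t ρ ≡ substitute t ρ
  ⟦⟧-substitute (var i)  ρ = refl
  ⟦⟧-substitute ε′       ρ = refl
  ⟦⟧-substitute (s ∙′ t) ρ = cong₂ _∙_ (⟦⟧-substitute s ρ) (⟦⟧-substitute t ρ)
  ⟦⟧-substitute (t ⁻¹′)  ρ = cong _⁻¹ (⟦⟧-substitute t ρ)

  letters : Word A → List A
  letters (letter a) = a ∷ []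
  letters ε          = []
  letters (v ∙ w)    = letters v ++ letters w
  letters (w ⁻¹)     = letters w

  Over-letters : ∀ w {s} → (∀ {a} → a ∈ letters w → a ∈ s) → Over s w
  Over-letters (letter a) p = p (here refl)
  Over-letters ε          p = tt
  Over-letters (v ∙ w)    p =
    Over-letters v (p ∘ ∈-++⁺ˡ) , Over-letters w (p ∘ ∈-++⁺ʳ (letters v))
  Over-letters (w ⁻¹)     p = Over-letters w p

  support : List (Word A) → List A
  support []       = []
  support (w ∷ ws) = letters w ++ support ws

  Over-support : ∀ ws {s} → (∀ {a} → a ∈ support ws → a ∈ s) →
    All (λ u → ∃ λ w → u ~ w × Over s w) ws
  Over-support []       p = []
  Over-support (w ∷ ws) p = (w , ~-refl , Over-letters w (p ∘ ∈-++⁺ˡ))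
    ∷ Over-support ws (p ∘ ∈-++⁺ʳ (letters w))

  Generated⇒Over : ∀ {ws u} → Generated group ws u → ∃ λ w → u ~ w × Over (support ws) w
  Generated⇒Over {ws} = Generated-⊆ group
    (λ u~v (w , u~w , o) → w , ~-trans (~-sym u~v) u~w , o)
    (ε , ~-refl , tt)
    (λ (v , p , o) (w , q , o′) → v ∙ w , ∙-cong p q , o , o′)
    (λ (w , p , o) → w ⁻¹ , ⁻¹-cong p , o)
    (Over-support ws id)

  -- The values of an assignment are replaced by equivalent words over the support, to which `law`
  -- applies.
  satisfies-support : ∀ ws e → E (f (support ws)) e → SatisfiesOn group (Generated group ws) e
  satisfies-support ws (l , r) Ee ρ ρ∈ =
    ~-trans (⟦⟧-cong group l ρ~σ) (~-trans
      (subst₂ _~_ (sym (⟦⟧-substitute l σ)) (sym (⟦⟧-substitute r σ))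
        (law (support ws) Ee σ (λ i → proj₂ (proj₂ (Generated⇒Over (ρ∈ i))))))
      (~-sym (⟦⟧-cong group r ρ~σ)))
    where
    σ = λ i → proj₁ (Generated⇒Over (ρ∈ i))
    ρ~σ = λ i → proj₁ (proj₂ (Generated⇒Over (ρ∈ i)))

  -- Von Dyck's theorem: a map on letters extends to a homomorphism if the images of each list `s`
  -- generate a subgroup obeying the laws imposed on words over `s`.
  module _ (G : Group ℓ ℓ) (φ : A → Group.Carrier G)
           (satisfies : ∀ s e → E (f s) e → SatisfiesOn G (Generated G (map φ s)) e) where
    private module G = Group G
    open GroupMorphisms (Group.rawGroup group) G.rawGroup

    extend : Word A → G.Carrier
    extend (letter a) = φ a
    extend ε          = G.ε
    extend (v ∙ w)    = extend v G.∙ extend w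
    extend (w ⁻¹)     = extend w G.⁻¹

    extend-substitute : ∀ t ρ → extend (substitute t ρ) ≡ ⟦_⟧ G t (extend ∘ ρ)
    extend-substitute (var i)  ρ = refl
    extend-substitute ε′       ρ = refl
    extend-substitute (s ∙′ t) ρ = cong₂ G._∙_ (extend-substitute s ρ) (extend-substitute t ρ)
    extend-substitute (t ⁻¹′)  ρ = cong G._⁻¹ (extend-substitute t ρ)

    extend-Over : ∀ {s} w → Over s w → Generated G (map φ s) (extend w)
    extend-Over (letter a) a∈      = gen (Any.map G.reflexive (∈-map⁺ φ a∈))
    extend-Over ε          _       = ε-mem
    extend-Over (v ∙ w)    (o , p) = ∙-mem (extend-Over v o) (extend-Over w p)
    extend-Over (w ⁻¹)     o       = ⁻¹-mem (extend-Over w o)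

    extend-cong : ∀ {u v} → u ~ v → extend u G.≈ extend v
    extend-cong ~-refl          = G.refl
    extend-cong (~-sym p)       = G.sym (extend-cong p)
    extend-cong (~-trans p q)   = G.trans (extend-cong p) (extend-cong q)
    extend-cong (∙-cong p q)    = G.∙-cong (extend-cong p) (extend-cong q)
    extend-cong (⁻¹-cong p)     = G.⁻¹-cong (extend-cong p)
    extend-cong (assoc u v w)   = G.assoc _ _ _
    extend-cong (identityˡ u)   = G.identityˡ _
    extend-cong (identityʳ u)   = G.identityʳ _
    extend-cong (inverseˡ u)    = G.inverseˡ _
    extend-cong (inverseʳ u)    = G.inverseʳ _
    extend-cong (law s {l} {r} Ee ρ o) = subst₂ G._≈_
      (sym (extend-substitute l ρ)) (sym (extend-substitute r ρ))
      (satisfies s (l , r) Ee (extend ∘ ρ) (λ i → extend-Over (ρ i) (o i)))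

    extend-isHomomorphism : IsGroupHomomorphism extend
    extend-isHomomorphism = record
      { isMonoidHomomorphism = record
        { isMagmaHomomorphism = record
          { isRelHomomorphism = record { cong = extend-cong }
          ; homo = λ _ _ → G.refl
          }
        ; ε-homo = G.refl
        }
      ; ⁻¹-homo = λ _ → G.refl
      }

-- Codes of words

module _ {K A : Set ℓ} (pair : K → K → K)
         (pair-injective : ∀ {x y x′ y′} → pair x y ≡ pair x′ y′ → x ≡ x′ × y ≡ y′)
         (ι : ℕ → K) (ι-injective : ∀ {m n} → ι m ≡ ι n → m ≡ n)
         (a : A → K) (a-injective : ∀ {x y} → a x ≡ a y → x ≡ y) where

  code : Word A → K
  code (letter x) = pair (ι 0) (a x)
  -- The tag alone identifies the word; the second entry is a filler.
  code ε          = pair (ι 1) (ι 0)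
  code (v ∙ w)    = pair (ι 2) (pair (code v) (code w))
  code (w ⁻¹)     = pair (ι 3) (code w)

  private
    tag : ∀ {m n x y} → pair (ι m) x ≡ pair (ι n) y → m ≡ n
    tag p = ι-injective (proj₁ (pair-injective p))

  code-injective : ∀ v w → code v ≡ code w → v ≡ w
  code-injective (letter x) (letter y) p = cong letter (a-injective (proj₂ (pair-injective p)))
  code-injective ε ε p = refl
  code-injective (v ∙ w) (v′ ∙ w′) p = cong₂ _∙_
    (code-injective v v′ (proj₁ q)) (code-injective w w′ (proj₂ q))
    where q = pair-injective (proj₂ (pair-injective p))
  code-injective (w ⁻¹) (w′ ⁻¹) p = cong _⁻¹ (code-injective w w′ (proj₂ (pair-injective p)))
  code-injective (letter _) ε       p = case tag p of λ ()
  code-injective (letter _) (_ ∙ _) p = case tag p of λ ()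
  code-injective (letter _) (_ ⁻¹)  p = case tag p of λ ()
  code-injective ε (letter _)       p = case tag p of λ ()
  code-injective ε (_ ∙ _)          p = case tag p of λ ()
  code-injective ε (_ ⁻¹)           p = case tag p of λ ()
  code-injective (_ ∙ _) (letter _) p = case tag p of λ ()
  code-injective (_ ∙ _) ε          p = case tag p of λ ()
  code-injective (_ ∙ _) (_ ⁻¹)     p = case tag p of λ ()
  code-injective (_ ⁻¹) (letter _)  p = case tag p of λ ()
  code-injective (_ ⁻¹) ε           p = case tag p of λ ()
  code-injective (_ ⁻¹) (_ ∙ _)     p = case tag p of λ ()

-- The epi-universal group

module EpiUniversality
  {𝒱 : ℕ → GroupClass ℓ ℓ} (variety : ∀ n → IsVariety (𝒱 n)) (ascending : ∀ n → 𝒱 n ⊆ 𝒱 (suc n))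
  {m : ℕ} {G₀ : Group ℓ ℓ} (G₀∈𝒱 : 𝒱 m G₀)
  {x₀ : Group.Carrier G₀} (x₀≉ε : ¬ (Group._≈_ G₀ x₀ (Group.ε G₀)))
  (lem : (P : Set ℓ) → Dec P) (normalForm : (A : Setoid ℓ ℓ) → NormalForm A)
  {K : Set ℓ} (closed : PowerClosed K)
  (ι : ℕ → K) (ι-injective : ∀ {m n} → ι m ≡ ι n → m ≡ n) (P : Prediction K) where

  open Prediction P
  open Varieties variety
  open Classical lem

  ascending-≤ : ∀ {m n G} → m ≤ n → 𝒱 m G → 𝒱 n G
  ascending-≤ m≤n = go (ℕ.≤⇒≤′ m≤n)
    where
    go : ∀ {m n G} → m ≤′ n → 𝒱 m G → 𝒱 n G
    go ≤′-refl     v = v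
    go (≤′-step p) v = ascending _ (go p v)

  -- Below m the varieties may be trivial, and the laws would identify generators.
  bound : List (L × K) → ℕ
  bound s = m + rank s

  open Presented E bound

  locally : Locally (⋃ ℕ 𝒱) group
  locally H (ws , H⇔ws) = bound (support ws) ,
    Equivalence.from (subgroup-variety _ H) λ e Ee ρ ρ∈ →
      satisfies-support ws e Ee ρ (λ i → Equivalence.to (H⇔ws (ρ i)) (ρ∈ i))

  L→K-injective : ∀ {x y} → Inverse.to L≈K x ≡ Inverse.to L≈K y → x ≡ y
  L→K-injective p = trans (sym (strictlyInverseʳ _)) (trans (cong from p) (strictlyInverseʳ _))
    where open Inverse L≈K

  private
    pair′ : K → K → K
    pair′ = pair lem closed ι ι-injective

    pair′-injective : ∀ {x y x′ y′} → pair′ x y ≡ pair′ x′ y′ → x ≡ x′ × y ≡ y′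
    pair′-injective = pair-injective lem closed ι ι-injective

    letterCode : L × K → K
    letterCode (x , c) = pair′ (Inverse.to L≈K x) c

    letterCode-injective : ∀ {a b} → letterCode a ≡ letterCode b → a ≡ b
    letterCode-injective p = let q , r = pair′-injective p in cong₂ _,_ (L→K-injective q) r

  wordCode : Word (L × K) → K
  wordCode = code pair′ pair′-injective ι ι-injective letterCode letterCode-injective

  wordCode-injective : ∀ {v w} → wordCode v ≡ wordCode w → v ≡ w
  wordCode-injective =
    code-injective pair′ pair′-injective ι ι-injective letterCode letterCode-injective _ _

  -- Chosen representatives embed the quotient into the words, which are coded in `K`.
  group≤K : ∣ group ∣ ≤ᶜ ≡.setoid K
  group≤K = record
    { to        = wordCode ∘ nf
    ; cong      = cong wordCode ∘ nf-cong
    ; injective = λ {v} {w} p → ~-trans (≈nf v)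
        (subst (_~ w) (sym (wordCode-injective p)) (~-sym (≈nf w)))
    }
    where
    nf = proj₁ (normalForm (Group.setoid group))
    ≈nf : ∀ w → w ~ nf w
    ≈nf = proj₁ (proj₂ (normalForm (Group.setoid group)))
    nf-cong : ∀ {v w} → v ~ w → nf v ≡ nf w
    nf-cong = proj₂ (proj₂ (normalForm (Group.setoid group)))

  -- Send `a` to `x₀` and all other letters to the identity. This extends to a homomorphism into
  -- `G₀`, as all bounds are at least `m`, and it separates `a` from the other letters.
  letter-injective : ∀ {a b} → letter a ~ letter b → a ≡ b
  letter-injective {a} {b} a~b = decidable-stable (lem (a ≡ b)) λ a≢b → x₀≉ε
    (G₀.trans (G₀.sym (φa≈x₀ a)) (G₀.trans (extend-cong G₀ (φ a) satisfies a~b) (φ≈ε a≢b)))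
    where
    module G₀ = Group G₀
    φ : L × K → L × K → G₀.Carrier
    φ a b with lem (a ≡ b)
    ... | yes _ = x₀
    ... | no _  = G₀.ε
    φa≈x₀ : ∀ a → φ a a G₀.≈ x₀
    φa≈x₀ a with lem (a ≡ a)
    ... | yes _ = G₀.refl
    ... | no p  = contradiction refl p
    φ≈ε : ∀ {a b} → ¬ (a ≡ b) → φ a b G₀.≈ G₀.ε
    φ≈ε {a} {b} a≢b with lem (a ≡ b)
    ... | yes p = contradiction p a≢b
    ... | no _  = G₀.refl
    satisfies : ∀ s e → E (bound s) e → SatisfiesOn G₀ (Generated G₀ (map (φ a) s)) e
    satisfies s e Ee ρ _ =
      Equivalence.to (proj₂ (variety (bound s)) G₀) (ascending-≤ (ℕ.m≤m+n m _) G₀∈𝒱) e Ee ρ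

  K≤group : ≡.setoid K ≤ᶜ ∣ group ∣
  K≤group = record
    -- A single index with all its predictions already gives κ letters.
    { to        = λ c → letter (Inverse.from L≈K (ι 0) , c)
    ; cong      = λ { refl → ~-refl }
    ; injective = cong proj₂ ∘ letter-injective
    }

  group≈K : ∣ group ∣ ≈ᶜ ≡.setoid K
  group≈K = schröderBernstein _ _ group≤K K≤group

  module _ (H : Group ℓ ℓ) (H-locally : Locally (⋃ ℕ 𝒱) H) (H≤K : ∣ H ∣ ≤ᶜ ≡.setoid K) where
    private module H = Group H

    point : L → H.Carrier
    point = retraction H.setoid H≤K H.ε ∘ Inverse.to L≈K

    point-surjective : ∀ h → ∃ λ x → point x H.≈ h
    point-surjective h = Inverse.from L≈K (Injection.to H≤K h) , H.trans
      (H.reflexive (cong (retraction H.setoid H≤K H.ε) (Inverse.strictlyInverseˡ L≈K _)))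
      (retraction-to H.setoid H≤K H.ε h)

    point-∈ : ∀ {x t} → x ∈ t → Generated H (map point t) (point x)
    point-∈ x∈ = gen (Any.map H.reflexive (∈-map⁺ point x∈))

    ranking : Ranking L
    ranking = record
      { Rank     = λ t n → 𝒱 n (Subgroup.group (⟨_⟩ H (map point t)))
      ; antitone = λ {s} {t} {n} s⊆t → subgroup-antitone n
          {H = ⟨_⟩ H (map point t)} {H′ = ⟨_⟩ H (map point s)}
          (Generated-mono H (All.map⁺ (tabulate (point-∈ ∘ s⊆t))))
      ; monotone = ascending-≤
      ; total    = λ s → H-locally (⟨_⟩ H (map point s)) (map point s , λ _ → mk⇔ id id)
      ; []-rank  = λ n → trivial-variety n H
      }

    OnBranch : L × K → Set ℓ
    OnBranch (x , c) = c ≡ branch ranking x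

    φ : L × K → H.Carrier
    φ a with lem (OnBranch a)
    ... | yes _ = point (proj₁ a)
    ... | no _  = H.ε

    φ-branch : ∀ x → φ (x , branch ranking x) ≡ point x
    φ-branch x with lem (OnBranch (x , branch ranking x))
    ... | yes _ = refl
    ... | no p  = contradiction refl p

    trace : List (L × K) → List L
    trace s = map proj₁ (filter (lem ∘ OnBranch) s)

    trace-onBranch : ∀ s {x} → x ∈ trace s → (x , branch ranking x) ∈ s
    trace-onBranch s x∈ with ∈-map⁻ proj₁ x∈
    ... | (x , c) , a∈ , refl with ∈-filter⁻ (lem ∘ OnBranch) {xs = s} a∈
    ...   | a∈s , refl = a∈s

    -- Letters with wrong predictions go to the identity, so only the trace contributes generators.
    φ-∈ : ∀ {s a} → a ∈ s → Generated H (map point (trace s)) (φ a)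
    φ-∈ {s} {a} a∈ with lem (OnBranch a)
    ... | yes on = point-∈ (∈-map⁺ proj₁ (∈-filter⁺ (lem ∘ OnBranch) a∈ on))
    ... | no _   = ε-mem

    -- The images of `s` lie in the subgroup generated by the points of the trace. By `rank-bounds`
    -- it is in `𝒱 (rank s)`, hence in the larger `𝒱 (bound s)`.
    φ-satisfies : ∀ s e → E (bound s) e → SatisfiesOn H (Generated H (map φ s)) e
    φ-satisfies s e Ee ρ ρ∈ =
      Equivalence.to (subgroup-variety (bound s) (⟨_⟩ H (map point (trace s))))
        (ascending-≤ (ℕ.m≤n+m _ m) (rank-bounds ranking s (trace s) (trace-onBranch s)))
        e Ee ρ (Generated-mono H (All.map⁺ (tabulate φ-∈)) ∘ ρ∈)

    extend-surjective : Surjective _~_ H._≈_ (extend H φ φ-satisfies)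
    extend-surjective h with point-surjective h
    ... | x , x≈h = letter (x , branch ranking x) , λ w~ → H.trans
      (extend-cong H φ φ-satisfies w~) (H.trans (H.reflexive (φ-branch x)) x≈h)

    epimorphism : EpimorphicImage H group
    epimorphism =
      extend H φ φ-satisfies , extend-isHomomorphism H φ φ-satisfies , extend-surjective

theorem3p4 : ∀ {ℓ : Level} → AxiomOfChoice ℓ →
    (𝒱 : ℕ → GroupClass ℓ ℓ) →
    (∀ n → IsVariety (𝒱 n)) →
    (∀ n → 𝒱 n ⊆ 𝒱 (suc n)) →
    Nontrivial (⋃ ℕ 𝒱) →
    (κ : Cardinal ℓ) →
    Infinite κ →
    IsWeakPowerFixed κ →
    Σ (Group ℓ ℓ) λ G → EpiUniversal (Locally (⋃ ℕ 𝒱)) κ G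
theorem3p4 ac 𝒱 variety ascending (_ , (_ , G₀∈𝒱) , _ , x₀≉ε) κ ℵ₀≤κ fixed =
  Presented.group E bound , locally , Inv.trans group≈K K≈κ , λ H (H-locally , H≤κ) →
    epimorphism H H-locally (Compose.injection H≤κ κ≤K)
  where
  lem = excludedMiddle ac
  -- From here on κ is represented by a type with propositional equality; the result is carried back
  -- along `K≈κ`.
  K = proj₁ (canonical ac κ)
  K≈κ = proj₂ (canonical ac κ)
  κ≤K : κ ≤ᶜ ≡.setoid K
  κ≤K = Bijection.injection (Inv.Inverse⇒Bijection (Inv.sym K≈κ))
  ℵ₀≤K = Compose.injection ℵ₀≤κ κ≤K
  closed = weakPowerFixed⇒powerClosed K≈κ fixed
  open Injection ℵ₀≤K renaming (to to ι; injective to ι-injective)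
  P = prediction lem closed ι ι-injective (shortOrder lem (normalForm ac) K)
  open EpiUniversality variety ascending G₀∈𝒱 x₀≉ε lem (normalForm ac) closed ι ι-injective P
  open Varieties variety
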